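{- The relation $\equiv_m$ of $m$-equivalence on $2^\mathbb{N}$ is $\Pi^0_2$-graphable with diameter $2$.
   Context: Subsets of $\mathbb{N}$ are identified with elements of $2^\mathbb{N}$. An $m$-reduction from $A$ to $B$ is a total computable $f:\mathbb{N}\to\mathbb{N}$ with $n\in A\iff f(n)\in B$ for all $n$; $A\le_m B$ if one exists, and $A\equiv_m B$ iff $A\le_m B$ and $B\le_m A$. An equivalence relation $E$ on a space $X$ is $\Gamma$-graphable (for a pointclass $\Gamma$, here lightface $\Pi^0_2$) if there is a simple undirected graph $G\subseteq X\times X$ in $\Gamma$ whose connectedness relation equals $E$; it is $\Gamma$-graphable with diameter $k$ if such a $G$ exists in which $k$ is the least integer such that any two $G$-connected points are joined by a path of length at most $k$. -}

module Defs where

open import Data.Bool using (Bool; true; false)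
open import Data.Fin using (Fin; zero; suc)
open import Data.Nat using (ℕ; zero; suc; _≤_; _<_)
open import Data.Product using (Σ; ∃; _×_)
open import Data.Unit using (⊤)
open import Data.Vec using (Vec; []; _∷_; lookup)
open import Function.Bundles using (_⇔_)
open import Level using (0ℓ)
open import Relation.Binary using (Rel; Setoid; Symmetric; Irreflexive; _Respects₂_)
open import Relation.Binary.PropositionalEquality using (_≡_; _→-setoid_)
open import Relation.Nullary.Reflects using (Reflects)

-- Points of 2^ℕ are characteristic functions.  There is no function
-- extensionality, so equality of points is pointwise equality.
2^ℕ : Set
2^ℕ = ℕ → Bool

Cantor : Setoid 0ℓ 0ℓ
Cantor = ℕ →-setoid Bool

infix 4 _∈_

_∈_ : ℕ → 2^ℕ → Set
n ∈ A = A n ≡ true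

------------------------------------------------------------------------
-- Kleene's partial recursive functions, relative to k set oracles

-- Code k n: programs for n-ary partial functions.  Recursion and search
-- are on the first argument.
data Code (k : ℕ) : ℕ → Set where
  zeroᶜ   : ∀ {n} → Code k n
  sucᶜ    : Code k 1
  projᶜ   : ∀ {n} → Fin n → Code k n
  oracleᶜ : Fin k → Code k 1
  compᶜ   : ∀ {m n} → Code k m → Vec (Code k n) m → Code k n
  precᶜ   : ∀ {n} → Code k n → Code k (suc (suc n)) → Code k (suc n)
  μᶜ      : ∀ {n} → Code k (suc n) → Code k n

bit : Bool → ℕ
bit false = 0
bit true  = 1

-- h(0,xs) = f(xs) and h(t+1,xs) = g(t,h(t,xs),xs), on graphs of partial functions.
PrimRec : ∀ {n} → (Vec ℕ n → ℕ → Set) → (Vec ℕ (suc (suc n)) → ℕ → Set) →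
          ℕ → Vec ℕ n → ℕ → Set
PrimRec F G zero    xs y = F xs y
PrimRec F G (suc t) xs y = ∃ λ z → PrimRec F G t xs z × G (t ∷ z ∷ xs) y

-- ⟦ c ⟧ α xs y: program c with oracles α halts on input xs with output y.
mutual
  ⟦_⟧ : ∀ {k n} → Code k n → (Fin k → 2^ℕ) → Vec ℕ n → ℕ → Set
  ⟦ zeroᶜ ⟧     α xs       y = y ≡ 0
  ⟦ sucᶜ ⟧      α (x ∷ []) y = y ≡ suc x
  ⟦ projᶜ i ⟧   α xs       y = y ≡ lookup xs i
  ⟦ oracleᶜ i ⟧ α (x ∷ []) y = y ≡ bit (α i x)
  ⟦ compᶜ f gs ⟧ α xs      y = ∃ λ zs → ⟦ gs ⟧* α xs zs × ⟦ f ⟧ α zs y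
  ⟦ precᶜ f g ⟧ α (t ∷ xs) y = PrimRec (⟦ f ⟧ α) (⟦ g ⟧ α) t xs y
  ⟦ μᶜ f ⟧      α xs       y =
    ⟦ f ⟧ α (y ∷ xs) 0 × (∀ i → i < y → ∃ λ z → ⟦ f ⟧ α (i ∷ xs) (suc z))

  ⟦_⟧* : ∀ {k n m} → Vec (Code k n) m → (Fin k → 2^ℕ) → Vec ℕ n → Vec ℕ m → Set
  ⟦ [] ⟧*     α xs []       = ⊤
  ⟦ g ∷ gs ⟧* α xs (z ∷ zs) = ⟦ g ⟧ α xs z × ⟦ gs ⟧* α xs zs

Computable : (ℕ → ℕ) → Set
Computable f = Σ (Code 0 1) λ c → ∀ x → ⟦ c ⟧ (λ ()) (x ∷ []) (f x)

------------------------------------------------------------------------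
-- m-reducibility

infix 4 _≤ₘ_ _≡ₘ_

IsMReduction : (ℕ → ℕ) → 2^ℕ → 2^ℕ → Set
IsMReduction f A B = Computable f × (∀ n → n ∈ A ⇔ f n ∈ B)

_≤ₘ_ : 2^ℕ → 2^ℕ → Set
A ≤ₘ B = ∃ λ f → IsMReduction f A B

_≡ₘ_ : 2^ℕ → 2^ℕ → Set
A ≡ₘ B = A ≤ₘ B × B ≤ₘ A

------------------------------------------------------------------------
-- The lightface finite Borel hierarchy on (2^ℕ)^k × ℕ^n

Pointset : ℕ → ℕ → Set₁
Pointset k n = (Fin k → 2^ℕ) → Vec ℕ n → Set

-- The characteristic function is computed by one oracle program that is
-- total for all oracles.
Recursive : ∀ {k n} → Pointset k n → Set
Recursive {k} {n} P = Σ (Code k n) λ c →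
  ∀ α xs → ∃ λ b → ⟦ c ⟧ α xs (bit b) × Reflects (P α xs) b

mutual
  data Σ⁰ {k n : ℕ} : ℕ → Pointset k n → Set₁ where
    recursive : ∀ {P} → Recursive P → Σ⁰ 0 P
    exists    : ∀ {j P} {Q : Pointset k (suc n)} → Π⁰ j Q →
                (∀ α xs → P α xs ⇔ (∃ λ m → Q α (m ∷ xs))) → Σ⁰ (suc j) P

  data Π⁰ {k n : ℕ} : ℕ → Pointset k n → Set₁ where
    recursive : ∀ {P} → Recursive P → Π⁰ 0 P
    forall′   : ∀ {j P} {Q : Pointset k (suc n)} → Σ⁰ j Q →
                (∀ α xs → P α xs ⇔ (∀ m → Q α (m ∷ xs))) → Π⁰ (suc j) P

Π⁰₂ : Rel 2^ℕ 0ℓ → Set₁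
Π⁰₂ G = Π⁰ {2} {0} 2 (λ α _ → G (α zero) (α (suc zero)))

------------------------------------------------------------------------
-- Graphs on a space X

module _ (X : Setoid 0ℓ 0ℓ) where
  open Setoid X renaming (Carrier to ∣X∣)

  -- The first field says that G is a subset of X × X, i.e. that it does
  -- not distinguish equal points.
  record IsSimpleGraph (G : Rel ∣X∣ 0ℓ) : Set where
    field
      respects    : G Respects₂ _≈_
      symmetric   : Symmetric G
      irreflexive : Irreflexive _≈_ G

  data Path (G : Rel ∣X∣ 0ℓ) : ℕ → Rel ∣X∣ 0ℓ where
    stop : ∀ {x y} → x ≈ y → Path G 0 x y
    step : ∀ {l x y z} → G x y → Path G l y z → Path G (suc l) x z

  Connected : Rel ∣X∣ 0ℓ → Rel ∣X∣ 0ℓ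
  Connected G x y = ∃ λ l → Path G l x y

  DiameterAtMost : Rel ∣X∣ 0ℓ → ℕ → Set
  DiameterAtMost G k = ∀ x y → Connected G x y → ∃ λ l → l ≤ k × Path G l x y

  HasDiameter : Rel ∣X∣ 0ℓ → ℕ → Set
  HasDiameter G k = DiameterAtMost G k × (∀ j → DiameterAtMost G j → k ≤ j)

  record GraphableWithDiameter (Γ : Rel ∣X∣ 0ℓ → Set₁) (E : Rel ∣X∣ 0ℓ) (k : ℕ) : Set₁ where
    field
      graph         : Rel ∣X∣ 0ℓ
      isSimpleGraph : IsSimpleGraph graph
      inΓ           : Γ graph
      connectedness : ∀ x y → E x y ⇔ Connected graph x y
      diameter      : HasDiameter graph k

{-# OPTIONS --safe #-}
module Submission where

-- A set C = 1ᵉ⁺¹ 0 B carries the number e = ⟨ p , q ⟩ as a readable tag.  Join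
-- A to C when B is nontrivial and either A = B or the programs p and q reduce
-- A to B and B to A.  As e is read off C, no quantifier over programs is left
-- and the relation is Π⁰₂.  If A ≡ₘ B are nontrivial, tagging B with programs
-- for the two reductions gives a common neighbour of A and B.  Two sets
-- without the element 0 carry no tag, so {1} and {2} are at distance 2.
--
-- Programs are run by a universal machine whose configurations are numbers
-- and whose step function is primitive recursive.  Every Code compiles to
-- it; conversely, unbounded search for the halting time turns a machine
-- program that always halts into a Code.

open import Axiom.ExcludedMiddle using (ExcludedMiddle)
open import Data.Bool using (true; false)
open import Data.Bool.Properties using (⇔→≡; ¬-not)
open import Data.Empty using (⊥; ⊥-elim)
open import Data.Fin using (Fin; zero; suc)
open import Data.Nat using (ℕ; zero; suc; pred; _+_; _∸_; _≤_; _<_; z≤n; s≤s; z<s)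
open import Data.Nat.Properties
open import Data.Product using (∃; _×_; _,_; proj₁; proj₂)
open import Data.Sum using (_⊎_; inj₁; inj₂; [_,_]′)
open import Data.Unit using (tt)
open import Data.Vec using (Vec; []; _∷_; lookup; head; tail; tabulate)
open import Data.Vec.Properties using (tabulate∘lookup)
open import Function using (_∘_; id)
open import Function.Bundles using (_⇔_; mk⇔; Equivalence)
open import Level using (0ℓ)
open import Relation.Binary.PropositionalEquality
open import Relation.Nullary using (¬_; yes; no)
open import Relation.Nullary.Reflects using (Reflects; ofʸ; ofⁿ)
open import Defs

-- Functions defined by total programs

private variable
  k m n : ℕ

Fun : ℕ → ℕ → Set
Fun k n = (Fin k → 2^ℕ) → Vec ℕ n → ℕ

-- A function is kept together with a program computing it totally, so everything assembled from the
-- combinators below is recursive by construction.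
record Def {k n} (F : Fun k n) : Set where
  constructor mkDef
  field
    code : Code k n
    runs : ∀ α xs → ⟦ code ⟧ α xs (F α xs)

record Def* {k n m} (σ : (Fin k → 2^ℕ) → Vec ℕ n → Vec ℕ m) : Set where
  constructor mkDef*
  field
    codes : Vec (Code k n) m
    runs* : ∀ α xs → ⟦ codes ⟧* α xs (σ α xs)

open Def
open Def*

private variable
  F G H : Fun k n

[]ᵈ : Def* {k} {n} (λ _ _ → [])
[]ᵈ = mkDef* [] (λ _ _ → tt)

infixr 5 _∷ᵈ_

_∷ᵈ_ : {σ : (Fin k → 2^ℕ) → Vec ℕ n → Vec ℕ m} →
       Def F → Def* σ → Def* (λ α xs → F α xs ∷ σ α xs)
c ∷ᵈ cs = mkDef* (code c ∷ codes cs) (λ α xs → runs c α xs , runs* cs α xs)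

substᵈ : {σ : (Fin k → 2^ℕ) → Vec ℕ n → Vec ℕ m} →
         Def F → Def* σ → Def (λ α xs → F α (σ α xs))
substᵈ {σ = σ} c cs =
  mkDef (compᶜ (code c) (codes cs)) (λ α xs → σ α xs , runs* cs α xs , runs c α (σ α xs))

tabulate-runs : ∀ {m} (ρ : Fin m → Fin n) (α : Fin k → 2^ℕ) (xs : Vec ℕ n) →
                ⟦ tabulate (projᶜ ∘ ρ) ⟧* α xs (tabulate (lookup xs ∘ ρ))
tabulate-runs {m = zero}  ρ α xs = tt
tabulate-runs {m = suc m} ρ α xs = refl , tabulate-runs (ρ ∘ suc) α xs

projectionsᵈ : {σ : Vec ℕ n → Vec ℕ m} (ρ : Fin m → Fin n) →
           (∀ xs → tabulate (lookup xs ∘ ρ) ≡ σ xs) → Def* {k} (λ _ → σ)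
projectionsᵈ ρ eq = mkDef* (tabulate (projᶜ ∘ ρ))
  (λ α xs → subst (⟦ tabulate (projᶜ ∘ ρ) ⟧* α xs) (eq xs) (tabulate-runs ρ α xs))

idᵈ : Def* {k} {n} (λ _ xs → xs)
idᵈ = projectionsᵈ id tabulate∘lookup

tailᵈ : Def* {k} {suc n} (λ _ xs → tail xs)
tailᵈ = projectionsᵈ suc λ { (x ∷ xs) → tabulate∘lookup xs }

tail²ᵈ : Def* {k} {suc (suc n)} (λ _ xs → tail (tail xs))
tail²ᵈ = projectionsᵈ (λ i → suc (suc i)) λ { (x ∷ y ∷ xs) → tabulate∘lookup xs }

headᵈ : Def {k} {suc n} (λ _ xs → head xs)
headᵈ = mkDef (projᶜ zero) λ { _ (x ∷ xs) → refl }

secondᵈ : Def {k} {suc (suc n)} (λ _ xs → head (tail xs))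
secondᵈ = substᵈ headᵈ tailᵈ

thirdᵈ : Def {k} {suc (suc (suc n))} (λ _ xs → head (tail (tail xs)))
thirdᵈ = substᵈ headᵈ tail²ᵈ

zeroᵈ : Def {k} {n} (λ _ _ → 0)
zeroᵈ = mkDef zeroᶜ (λ _ _ → refl)

sucᵈ : Def F → Def (λ α xs → suc (F α xs))
sucᵈ c = substᵈ (mkDef {F = λ _ xs → suc (head xs)} sucᶜ λ { _ (x ∷ []) → refl }) (c ∷ᵈ []ᵈ)

varᵈ : (i : Fin n) → Def {k} (λ _ xs → lookup xs i)
varᵈ i = mkDef (projᶜ i) (λ _ _ → refl)

oracleᵈ : (i : Fin k) → Def F → Def (λ α xs → bit (α i (F α xs)))
oracleᵈ i c =
  substᵈ (mkDef {F = λ α xs → bit (α i (head xs))} (oracleᶜ i) λ { _ (x ∷ []) → refl })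
         (c ∷ᵈ []ᵈ)

constᵈ : ∀ m → Def {k} {n} (λ _ _ → m)
constᵈ zero    = zeroᵈ
constᵈ (suc m) = sucᵈ (constᵈ m)

-- Any `h` satisfying the two recursion equations qualifies, so functions written by ordinary
-- structural recursion obtain programs directly.
recᵈ : (h : (Fin k → 2^ℕ) → Vec ℕ n → ℕ → ℕ) → Def F → Def G →
       (∀ α xs → F α xs ≡ h α xs 0) →
       (∀ α xs t → G α (t ∷ h α xs t ∷ xs) ≡ h α xs (suc t)) →
       Def H → Def (λ α xs → h α xs (H α xs))
recᵈ h cF cG base next cH =
  substᵈ (mkDef {F = λ α xs → h α (tail xs) (head xs)} (precᶜ (code cF) (code cG))
           λ { α (t ∷ xs) → go α xs t }) (cH ∷ᵈ idᵈ)
  where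
  go : ∀ α xs t → PrimRec (⟦ code cF ⟧ α) (⟦ code cG ⟧ α) t xs (h α xs t)
  go α xs zero    = subst (⟦ code cF ⟧ α xs) (base α xs) (runs cF α xs)
  go α xs (suc t) = h α xs t , go α xs t ,
    subst (⟦ code cG ⟧ α _) (next α xs t) (runs cG α _)

infixl 6 _+ᵈ_ _∸ᵈ_

_+ᵈ_ : Def F → Def G → Def (λ α xs → F α xs + G α xs)
_+ᵈ_ {G = G} c d =
  recᵈ (λ α xs t → t + G α xs) d (sucᵈ (varᵈ (suc zero)))
       (λ _ _ → refl) (λ _ _ _ → refl) c

predᵈ : Def F → Def (λ α xs → pred (F α xs))
predᵈ = recᵈ (λ _ _ → pred) zeroᵈ (varᵈ zero) (λ _ _ → refl) (λ _ _ _ → refl)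

_∸ᵈ_ : Def F → Def G → Def (λ α xs → F α xs ∸ G α xs)
_∸ᵈ_ {F = F} c =
  recᵈ (λ α xs t → F α xs ∸ t) c (predᵈ (varᵈ (suc zero)))
       (λ _ _ → refl) (λ α xs t → pred[m∸n]≡m∸[1+n] (F α xs) t)

ifz : ℕ → ℕ → ℕ → ℕ
ifz zero    a b = a
ifz (suc _) a b = b

ifzᵈ : Def F → Def G → Def H → Def (λ α xs → ifz (F α xs) (G α xs) (H α xs))
ifzᵈ {G = G} {H = H} c d e =
  recᵈ (λ α xs t → ifz t (G α xs) (H α xs)) d (substᵈ e tail²ᵈ)
       (λ _ _ → refl) (λ _ _ _ → refl) c

-- The distance of `a` and `b`: one of the two truncated differences is always 0. It turns equations
-- into zero tests.
diff : ℕ → ℕ → ℕ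
diff a b = (a ∸ b) + (b ∸ a)

diffᵈ : Def F → Def G → Def (λ α xs → diff (F α xs) (G α xs))
diffᵈ c d = (c ∸ᵈ d) +ᵈ (d ∸ᵈ c)

diff-bit : ∀ {a b} → a ≡ b → diff (bit a) (bit b) ≡ 0
diff-bit {false} refl = refl
diff-bit {true}  refl = refl

diff-bit⁻¹ : ∀ a b → diff (bit a) (bit b) ≡ 0 → a ≡ b
diff-bit⁻¹ false false _ = refl
diff-bit⁻¹ true  true  _ = refl

-- Cantor pairing

tri : ℕ → ℕ
tri zero    = 0
tri (suc n) = suc (n + tri n)

triᵈ : Def F → Def (λ α xs → tri (F α xs))
triᵈ = recᵈ (λ _ _ → tri) zeroᵈ (sucᵈ (varᵈ zero +ᵈ varᵈ (suc zero)))
            (λ _ _ → refl) (λ _ _ _ → refl)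

-- The largest `s` with `tri s ≤ z`. It grows by at most one when `z` does, so a single comparison
-- updates it.
root : ℕ → ℕ
root zero    = 0
root (suc z) = ifz (tri (suc (root z)) ∸ suc z) (suc (root z)) (root z)

rootᵈ : Def F → Def (λ α xs → root (F α xs))
rootᵈ = recᵈ (λ _ _ → root) zeroᵈ
  (ifzᵈ (triᵈ (sucᵈ r) ∸ᵈ sucᵈ (varᵈ zero)) (sucᵈ r) r)
  (λ _ _ → refl) (λ _ _ _ → refl)
  where r = varᵈ (suc zero)

ifz-pos : ∀ {t a b} → 0 < t → ifz t a b ≡ b
ifz-pos (s≤s _) = refl

root-tri : ∀ s a → a ≤ s → root (a + tri s) ≡ s
root-tri zero    zero    _   = refl
root-tri (suc s) zero    _
  rewrite root-tri s s ≤-refl | n∸n≡0 (s + tri s) = refl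
root-tri s       (suc a) a<s
  rewrite root-tri s a (<⇒≤ a<s) = ifz-pos (m<n⇒0<n∸m (s≤s (+-monoˡ-≤ (tri s) a<s)))

opaque
  ⟨_,_⟩ : ℕ → ℕ → ℕ
  ⟨ a , b ⟩ = a + tri (a + b)

  π₁ : ℕ → ℕ
  π₁ z = z ∸ tri (root z)

  π₂ : ℕ → ℕ
  π₂ z = root z ∸ π₁ z

  π₁-⟨⟩ : ∀ a b → π₁ ⟨ a , b ⟩ ≡ a
  π₁-⟨⟩ a b rewrite root-tri (a + b) a (m≤m+n a b) = m+n∸n≡m a (tri (a + b))

  π₂-⟨⟩ : ∀ a b → π₂ ⟨ a , b ⟩ ≡ b
  π₂-⟨⟩ a b rewrite π₁-⟨⟩ a b | root-tri (a + b) a (m≤m+n a b) = m+n∸m≡n a b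

  ⟨_,_⟩ᵈ : Def F → Def G → Def (λ α xs → ⟨ F α xs , G α xs ⟩)
  ⟨ c , d ⟩ᵈ = c +ᵈ triᵈ (c +ᵈ d)

  π₁ᵈ : Def F → Def (λ α xs → π₁ (F α xs))
  π₁ᵈ c = c ∸ᵈ triᵈ (rootᵈ c)

  π₂ᵈ : Def F → Def (λ α xs → π₂ (F α xs))
  π₂ᵈ c = rootᵈ c ∸ᵈ π₁ᵈ c

-- A universal machine

-- A configuration ⟨ K , v ⟩ consists of a stack K of instructions still to
-- be executed and a current value v.  It is halted when K = 0.

push : ℕ → ℕ → ℕ
push i K = suc ⟨ i , K ⟩

pushᵈ : Def F → Def G → Def (λ α xs → push (F α xs) (G α xs))
pushᵈ c d = sucᵈ ⟨ c , d ⟩ᵈ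

zeroᴵ sucᴵ fstᴵ sndᴵ idᴵ : ℕ
zeroᴵ = ⟨ 0 , 0 ⟩
sucᴵ  = ⟨ 1 , 0 ⟩
fstᴵ  = ⟨ 2 , 0 ⟩
sndᴵ  = ⟨ 3 , 0 ⟩
idᴵ   = ⟨ 11 , 0 ⟩

-- An instruction pairs an operation code with its argument. `fork₂ᴵ`, `fork₃ᴵ` and `testᴵ` are
-- continuation frames: the first stores the second branch and the saved input, the second stores
-- the first result, and the third inspects the outcome of one search trial.
compᴵ forkᴵ fork₂ᴵ precᴵ : ℕ → ℕ → ℕ
compᴵ  f g = ⟨ 4 , ⟨ f , g ⟩ ⟩
forkᴵ  f g = ⟨ 5 , ⟨ f , g ⟩ ⟩
fork₂ᴵ g v = ⟨ 6 , ⟨ g , v ⟩ ⟩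
precᴵ  f g = ⟨ 8 , ⟨ f , g ⟩ ⟩

fork₃ᴵ loopᴵ testᴵ : ℕ → ℕ
fork₃ᴵ w = ⟨ 7 , w ⟩
loopᴵ  f = ⟨ 9 , f ⟩
testᴵ  f = ⟨ 10 , f ⟩

-- One unfolding of primitive recursion, applied to the value ⟨ t , xs ⟩
-- when the recursion argument is t + 1.
unfoldᴵ : ℕ → ℕ → ℕ
unfoldᴵ self g = compᴵ g (forkᴵ fstᴵ (forkᴵ self sndᴵ))

-- Once the earlier tests have failed, `t ∸ j` vanishes only at `t = j`, so this is a dispatch on
-- the operation code `t`. Codes from 11 on act as the identity, which covers `idᴵ`.
exec : ℕ → ℕ → ℕ → ℕ → ℕ
exec t a K v =
  ifz t ⟨ K , 0 ⟩ (
  ifz (t ∸ 1) ⟨ K , suc v ⟩ (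
  ifz (t ∸ 2) ⟨ K , π₁ v ⟩ (
  ifz (t ∸ 3) ⟨ K , π₂ v ⟩ (
  ifz (t ∸ 4) ⟨ push (π₂ a) (push (π₁ a) K) , v ⟩ (
  ifz (t ∸ 5) ⟨ push (π₁ a) (push (fork₂ᴵ (π₂ a) v) K) , v ⟩ (
  ifz (t ∸ 6) ⟨ push (π₁ a) (push (fork₃ᴵ v) K) , π₂ a ⟩ (
  ifz (t ∸ 7) ⟨ K , ⟨ a , v ⟩ ⟩ (
  ifz (t ∸ 8) (ifz (π₁ v) ⟨ push (π₁ a) K , π₂ v ⟩
                          -- `⟨ 8 , a ⟩` is the recursion instruction itself, rebuilt for the
                          -- recursive call.
                          ⟨ push (unfoldᴵ ⟨ 8 , a ⟩ (π₂ a)) K , ⟨ pred (π₁ v) , π₂ v ⟩ ⟩) (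
  ifz (t ∸ 9) ⟨ push (forkᴵ a idᴵ) (push (testᴵ a) K) , v ⟩ (
  ifz (t ∸ 10) (ifz (π₁ v) ⟨ K , π₁ (π₂ v) ⟩
                           ⟨ push (loopᴵ a) K , ⟨ suc (π₁ (π₂ v)) , π₂ (π₂ v) ⟩ ⟩)
  ⟨ K , v ⟩))))))))))

execᵈ : {T A K V : Fun k n} → Def T → Def A → Def K → Def V →
        Def (λ α xs → exec (T α xs) (A α xs) (K α xs) (V α xs))
execᵈ t a K v =
  ifzᵈ t ⟨ K , zeroᵈ ⟩ᵈ (
  ifzᵈ (t ∸ᵈ constᵈ 1) ⟨ K , sucᵈ v ⟩ᵈ (
  ifzᵈ (t ∸ᵈ constᵈ 2) ⟨ K , π₁ᵈ v ⟩ᵈ (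
  ifzᵈ (t ∸ᵈ constᵈ 3) ⟨ K , π₂ᵈ v ⟩ᵈ (
  ifzᵈ (t ∸ᵈ constᵈ 4) ⟨ pushᵈ (π₂ᵈ a) (pushᵈ (π₁ᵈ a) K) , v ⟩ᵈ (
  ifzᵈ (t ∸ᵈ constᵈ 5) ⟨ pushᵈ (π₁ᵈ a) (pushᵈ (opᵈ 6 ⟨ π₂ᵈ a , v ⟩ᵈ) K) , v ⟩ᵈ (
  ifzᵈ (t ∸ᵈ constᵈ 6) ⟨ pushᵈ (π₁ᵈ a) (pushᵈ (opᵈ 7 v) K) , π₂ᵈ a ⟩ᵈ (
  ifzᵈ (t ∸ᵈ constᵈ 7) ⟨ K , ⟨ a , v ⟩ᵈ ⟩ᵈ (
  ifzᵈ (t ∸ᵈ constᵈ 8)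
    (ifzᵈ (π₁ᵈ v) ⟨ pushᵈ (π₁ᵈ a) K , π₂ᵈ v ⟩ᵈ
      ⟨ pushᵈ (opᵈ 4 ⟨ π₂ᵈ a , opᵈ 5 ⟨ opᵈ 2 zeroᵈ , opᵈ 5 ⟨ opᵈ 8 a , opᵈ 3 zeroᵈ ⟩ᵈ ⟩ᵈ ⟩ᵈ) K
      , ⟨ predᵈ (π₁ᵈ v) , π₂ᵈ v ⟩ᵈ ⟩ᵈ) (
  ifzᵈ (t ∸ᵈ constᵈ 9)
    ⟨ pushᵈ (opᵈ 5 ⟨ a , opᵈ 11 zeroᵈ ⟩ᵈ) (pushᵈ (opᵈ 10 a) K) , v ⟩ᵈ (
  ifzᵈ (t ∸ᵈ constᵈ 10)
    (ifzᵈ (π₁ᵈ v) ⟨ K , π₁ᵈ (π₂ᵈ v) ⟩ᵈ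
      ⟨ pushᵈ (opᵈ 9 a) K , ⟨ sucᵈ (π₁ᵈ (π₂ᵈ v)) , π₂ᵈ (π₂ᵈ v) ⟩ᵈ ⟩ᵈ)
  ⟨ K , v ⟩ᵈ))))))))))
  where
  opᵈ : ∀ t {A : Fun k n} → Def A → Def (λ α xs → ⟨ t , A α xs ⟩)
  opᵈ t c = ⟨ constᵈ t , c ⟩ᵈ

-- `pred` undoes the successor that `push` adds to keep nonempty stacks different from 0. Halted
-- configurations are left fixed.
stepᴹ : ℕ → ℕ
stepᴹ c = ifz (π₁ c) c
  (exec (π₁ (π₁ (pred (π₁ c)))) (π₂ (π₁ (pred (π₁ c)))) (π₂ (pred (π₁ c))) (π₂ c))

stepᵈ : Def F → Def (λ α xs → stepᴹ (F α xs))
stepᵈ c = ifzᵈ (π₁ᵈ c) c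
  (execᵈ (π₁ᵈ (π₁ᵈ (predᵈ (π₁ᵈ c)))) (π₂ᵈ (π₁ᵈ (predᵈ (π₁ᵈ c)))) (π₂ᵈ (predᵈ (π₁ᵈ c)))
         (π₂ᵈ c))

run : ℕ → ℕ → ℕ
run zero    c = c
run (suc s) c = stepᴹ (run s c)

runᵈ : Def F → Def G → Def (λ α xs → run (F α xs) (G α xs))
runᵈ {G = G} c d =
  recᵈ (λ α xs s → run s (G α xs)) d (stepᵈ (varᵈ (suc zero)))
       (λ _ _ → refl) (λ _ _ _ → refl) c

run-+ : ∀ s t c → run (t + s) c ≡ run t (run s c)
run-+ s zero    c = refl
run-+ s (suc t) c = cong stepᴹ (run-+ s t c)

run-halted : ∀ t c → π₁ c ≡ 0 → run t c ≡ c
run-halted zero    c h = refl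
run-halted (suc t) c h rewrite run-halted t c h | h = refl

-- Halted configurations are fixed points, so the longer run only idles after the end of the shorter
-- one.
run-halted-unique : ∀ s t c → π₁ (run s c) ≡ 0 → π₁ (run t c) ≡ 0 → run s c ≡ run t c
run-halted-unique s t c hs ht =
  [ (λ s≤t → sym (ahead s≤t hs)) , (λ t≤s → ahead t≤s ht) ]′ (≤-total s t)
  where
  ahead : ∀ {s t} → s ≤ t → π₁ (run s c) ≡ 0 → run t c ≡ run s c
  ahead {s} {t} s≤t h = begin
    run t c               ≡⟨ cong (λ u → run u c) (m∸n+n≡m s≤t) ⟨
    run (t ∸ s + s) c     ≡⟨ run-+ s (t ∸ s) c ⟩
    run (t ∸ s) (run s c) ≡⟨ run-halted (t ∸ s) _ h ⟩
    run s c               ∎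
    where open ≡-Reasoning

infix 4 _⟶*_

_⟶*_ : ℕ → ℕ → Set
c ⟶* d = ∃ λ s → run s c ≡ d

infixr 5 _⨾_

_⨾_ : ∀ {a b c} → a ⟶* b → b ⟶* c → a ⟶* c
_⨾_ {a} (s , p) (t , q) = t + s , trans (run-+ s t a) (trans (cong (run t) p) q)

one : ∀ {a b} → stepᴹ a ≡ b → a ⟶* b
one p = 1 , p

-- Decodes the fetched instruction once for all; at a numeral operation code `exec` then computes.
step-push : ∀ t a K v → stepᴹ ⟨ push ⟨ t , a ⟩ K , v ⟩ ≡ exec t a K v
step-push t a K v
  rewrite π₁-⟨⟩ (push ⟨ t , a ⟩ K) v | π₂-⟨⟩ (push ⟨ t , a ⟩ K) v
        | π₁-⟨⟩ ⟨ t , a ⟩ K | π₂-⟨⟩ ⟨ t , a ⟩ K | π₁-⟨⟩ t a | π₂-⟨⟩ t a = refl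

zero-runs : ∀ K v → ⟨ push zeroᴵ K , v ⟩ ⟶* ⟨ K , 0 ⟩
zero-runs K v = one (step-push 0 0 K v)

suc-runs : ∀ K v → ⟨ push sucᴵ K , v ⟩ ⟶* ⟨ K , suc v ⟩
suc-runs K v = one (step-push 1 0 K v)

fst-runs : ∀ K a b → ⟨ push fstᴵ K , ⟨ a , b ⟩ ⟩ ⟶* ⟨ K , a ⟩
fst-runs K a b = one (trans (step-push 2 0 K _) (cong ⟨ K ,_⟩ (π₁-⟨⟩ a b)))

snd-runs : ∀ K a b → ⟨ push sndᴵ K , ⟨ a , b ⟩ ⟩ ⟶* ⟨ K , b ⟩
snd-runs K a b = one (trans (step-push 3 0 K _) (cong ⟨ K ,_⟩ (π₂-⟨⟩ a b)))

id-runs : ∀ K v → ⟨ push idᴵ K , v ⟩ ⟶* ⟨ K , v ⟩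
id-runs K v = one (step-push 11 0 K v)

comp-runs : ∀ f g K v → ⟨ push (compᴵ f g) K , v ⟩ ⟶* ⟨ push g (push f K) , v ⟩
comp-runs f g K v = one (trans (step-push 4 ⟨ f , g ⟩ K v)
  (cong₂ (λ a b → ⟨ push b (push a K) , v ⟩) (π₁-⟨⟩ f g) (π₂-⟨⟩ f g)))

-- The two branches run above different frames, hence the hypotheses for arbitrary stacks.
fork-runs : ∀ {f g K v a b} →
            (∀ K → ⟨ push f K , v ⟩ ⟶* ⟨ K , a ⟩) → (∀ K → ⟨ push g K , v ⟩ ⟶* ⟨ K , b ⟩) →
            ⟨ push (forkᴵ f g) K , v ⟩ ⟶* ⟨ K , ⟨ a , b ⟩ ⟩
fork-runs {f} {g} {K} {v} {a} {b} fr gr =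
  one (trans (step-push 5 ⟨ f , g ⟩ K v)
    (cong₂ (λ a b → ⟨ push a (push (fork₂ᴵ b v) K) , v ⟩) (π₁-⟨⟩ f g) (π₂-⟨⟩ f g))) ⨾
  fr _ ⨾
  one (trans (step-push 6 ⟨ g , v ⟩ K a)
    (cong₂ (λ g v → ⟨ push g (push (fork₃ᴵ a) K) , v ⟩) (π₁-⟨⟩ g v) (π₂-⟨⟩ g v))) ⨾
  gr _ ⨾
  one (step-push 7 a K b)

prec-zero-runs : ∀ f g K v → ⟨ push (precᴵ f g) K , ⟨ 0 , v ⟩ ⟩ ⟶* ⟨ push f K , v ⟩
prec-zero-runs f g K v = one (trans (step-push 8 ⟨ f , g ⟩ K _) eq)
  where
  eq : exec 8 ⟨ f , g ⟩ K ⟨ 0 , v ⟩ ≡ ⟨ push f K , v ⟩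
  eq rewrite π₁-⟨⟩ 0 v | π₂-⟨⟩ 0 v | π₁-⟨⟩ f g = refl

prec-suc-runs : ∀ f g K t v → ⟨ push (precᴵ f g) K , ⟨ suc t , v ⟩ ⟩ ⟶*
                              ⟨ push (unfoldᴵ (precᴵ f g) g) K , ⟨ t , v ⟩ ⟩
prec-suc-runs f g K t v = one (trans (step-push 8 ⟨ f , g ⟩ K _) eq)
  where
  eq : exec 8 ⟨ f , g ⟩ K ⟨ suc t , v ⟩ ≡ ⟨ push (unfoldᴵ (precᴵ f g) g) K , ⟨ t , v ⟩ ⟩
  eq rewrite π₁-⟨⟩ (suc t) v | π₂-⟨⟩ (suc t) v | π₂-⟨⟩ f g = refl

loop-runs : ∀ {f i v r} K → (∀ K → ⟨ push f K , ⟨ i , v ⟩ ⟩ ⟶* ⟨ K , r ⟩) →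
            ⟨ push (loopᴵ f) K , ⟨ i , v ⟩ ⟩ ⟶* ⟨ push (testᴵ f) K , ⟨ r , ⟨ i , v ⟩ ⟩ ⟩
loop-runs {f} K fr = one (step-push 9 f K _) ⨾ fork-runs fr (λ K → id-runs K _)

test-zero-runs : ∀ f K i v → ⟨ push (testᴵ f) K , ⟨ 0 , ⟨ i , v ⟩ ⟩ ⟩ ⟶* ⟨ K , i ⟩
test-zero-runs f K i v = one (trans (step-push 10 f K _) eq)
  where
  eq : exec 10 f K ⟨ 0 , ⟨ i , v ⟩ ⟩ ≡ ⟨ K , i ⟩
  eq rewrite π₁-⟨⟩ 0 ⟨ i , v ⟩ | π₂-⟨⟩ 0 ⟨ i , v ⟩ | π₁-⟨⟩ i v = refl

test-suc-runs : ∀ f K r i v → ⟨ push (testᴵ f) K , ⟨ suc r , ⟨ i , v ⟩ ⟩ ⟩ ⟶*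
                              ⟨ push (loopᴵ f) K , ⟨ suc i , v ⟩ ⟩
test-suc-runs f K r i v = one (trans (step-push 10 f K _) eq)
  where
  eq : exec 10 f K ⟨ suc r , ⟨ i , v ⟩ ⟩ ≡ ⟨ push (loopᴵ f) K , ⟨ suc i , v ⟩ ⟩
  eq rewrite π₁-⟨⟩ (suc r) ⟨ i , v ⟩ | π₂-⟨⟩ (suc r) ⟨ i , v ⟩ | π₁-⟨⟩ i v | π₂-⟨⟩ i v = refl

-- Compilation of programs to the machine

enc : Vec ℕ n → ℕ
enc []       = 0
enc (x ∷ xs) = ⟨ x , enc xs ⟩

lookupᴵ : Fin n → ℕ
lookupᴵ zero    = fstᴵ
lookupᴵ (suc i) = compᴵ (lookupᴵ i) sndᴵ

mutual
  -- Reductions use no oracle, so there is no oracle instruction: `Code 0` has no instance of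
  -- `oracleᶜ`.
  compile : Code 0 n → ℕ
  compile zeroᶜ        = zeroᴵ
  compile sucᶜ         = compᴵ sucᴵ fstᴵ
  compile (projᶜ i)    = lookupᴵ i
  compile (compᶜ f gs) = compᴵ (compile f) (compile* gs)
  compile (precᶜ f g)  = precᴵ (compile f) (compile g)
  -- The fork puts the first candidate 0 in front of the arguments.
  compile (μᶜ f)       = compᴵ (loopᴵ (compile f)) (forkᴵ zeroᴵ idᴵ)

  compile* : Vec (Code 0 n) m → ℕ
  compile* []       = zeroᴵ
  compile* (g ∷ gs) = forkᴵ (compile g) (compile* gs)

lookup-runs : ∀ (i : Fin n) xs K → ⟨ push (lookupᴵ i) K , enc xs ⟩ ⟶* ⟨ K , lookup xs i ⟩
lookup-runs zero    (x ∷ xs) K = fst-runs K x (enc xs)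
lookup-runs (suc i) (x ∷ xs) K =
  comp-runs _ _ K _ ⨾ snd-runs _ x (enc xs) ⨾ lookup-runs i xs K

mutual
  -- Induction on the program, following the evidence that it halts. `K` stays arbitrary because
  -- subprograms run above the frames of their callers.
  compile-runs : ∀ (c : Code 0 n) {α} xs y → ⟦ c ⟧ α xs y →
                 ∀ K → ⟨ push (compile c) K , enc xs ⟩ ⟶* ⟨ K , y ⟩
  compile-runs zeroᶜ xs y refl K = zero-runs K (enc xs)
  compile-runs sucᶜ (x ∷ []) y refl K = comp-runs _ _ K _ ⨾ fst-runs _ x 0 ⨾ suc-runs K x
  compile-runs (projᶜ i) xs y refl K = lookup-runs i xs K
  compile-runs (compᶜ f gs) xs y (zs , dgs , df) K =
    comp-runs _ _ K _ ⨾ compile*-runs gs xs zs dgs _ ⨾ compile-runs f zs y df K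
  compile-runs (precᶜ f g) (t ∷ xs) y d K = prec-runs f g t xs y d K
  compile-runs (μᶜ f) xs y (d , ds) K =
    comp-runs _ _ K _ ⨾
    fork-runs (λ K → zero-runs K _) (λ K → id-runs K _) ⨾
    μ-runs f y 0 (+-identityʳ y) xs d ds K

  compile*-runs : ∀ (gs : Vec (Code 0 n) m) {α} xs zs → ⟦ gs ⟧* α xs zs →
                  ∀ K → ⟨ push (compile* gs) K , enc xs ⟩ ⟶* ⟨ K , enc zs ⟩
  compile*-runs []       xs []       _        K = zero-runs K (enc xs)
  compile*-runs (g ∷ gs) xs (z ∷ zs) (d , ds) K =
    fork-runs (compile-runs g xs z d) (compile*-runs gs xs zs ds)

  prec-runs : ∀ (f : Code 0 n) g {α} t xs y → PrimRec (⟦ f ⟧ α) (⟦ g ⟧ α) t xs y →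
              ∀ K → ⟨ push (precᴵ (compile f) (compile g)) K , ⟨ t , enc xs ⟩ ⟩ ⟶* ⟨ K , y ⟩
  prec-runs f g zero    xs y d            K =
    prec-zero-runs _ _ K (enc xs) ⨾ compile-runs f xs y d K
  prec-runs f g (suc t) xs y (z , d , dg) K =
    prec-suc-runs _ _ K t (enc xs) ⨾
    comp-runs _ _ K _ ⨾
    -- The nested forks assemble `⟨ t , ⟨ z , enc xs ⟩ ⟩`, the code of `t ∷ z ∷ xs`.
    fork-runs (λ K → fst-runs K t (enc xs))
      (λ K → fork-runs (prec-runs f g t xs z d) (λ K → snd-runs K t (enc xs))) ⨾
    compile-runs g (t ∷ z ∷ xs) y dg K

  -- The search has d candidates left before it reaches the answer d + i.
  μ-runs : ∀ (f : Code 0 (suc n)) {α} d i {y} → d + i ≡ y → ∀ xs →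
           ⟦ f ⟧ α (y ∷ xs) 0 → (∀ j → j < y → ∃ λ z → ⟦ f ⟧ α (j ∷ xs) (suc z)) →
           ∀ K → ⟨ push (loopᴵ (compile f)) K , ⟨ i , enc xs ⟩ ⟩ ⟶* ⟨ K , y ⟩
  μ-runs f zero    i refl xs h hs K =
    loop-runs K (compile-runs f (i ∷ xs) 0 h) ⨾ test-zero-runs _ K i (enc xs)
  μ-runs f (suc d) i refl xs h hs K =
    loop-runs K (compile-runs f (i ∷ xs) _ (proj₂ (hs i (s≤s (m≤n+m i d))))) ⨾
    test-suc-runs _ K _ i (enc xs) ⨾
    μ-runs f d (suc i) (+-suc d i) xs h hs K

-- m-reducibility

-- For Boolean characteristic functions the equivalence of memberships amounts to equality of
-- values, which is easier to chain.
Red : (ℕ → ℕ) → 2^ℕ → 2^ℕ → Set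
Red f A B = ∀ n → A n ≡ B (f n)

computable : {F : Fun 0 1} → Def F → Computable (λ x → F (λ ()) (x ∷ []))
computable c = code c , λ x → runs c (λ ()) (x ∷ [])

reduction : ∀ {A B} f → Computable f → Red f A B → A ≤ₘ B
reduction f c r = f , c , λ n → mk⇔ (trans (sym (r n))) (trans (r n))

reduction⁻¹ : ∀ {A B} → ((f , _) : A ≤ₘ B) → Red f A B
reduction⁻¹ (f , _ , iff) n = ⇔→≡ (iff n)

≤ₘ-reflexive : ∀ {A B} → (∀ n → A n ≡ B n) → A ≤ₘ B
≤ₘ-reflexive = reduction id (projᶜ zero , λ _ → refl)

≤ₘ-trans : ∀ {A B C} → A ≤ₘ B → B ≤ₘ C → A ≤ₘ C
≤ₘ-trans {A} {B} {C} r@(f , (c , cr) , _) s@(g , (d , dr) , _) = reduction {A} {C} (g ∘ f)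
  (compᶜ d (c ∷ []) , λ x → f x ∷ [] , (cr x , tt) , dr (f x))
  (λ n → trans (reduction⁻¹ {A} {B} r n) (reduction⁻¹ {B} {C} s (f n)))

≡ₘ-reflexive : ∀ {A B} → (∀ n → A n ≡ B n) → A ≡ₘ B
≡ₘ-reflexive eq = ≤ₘ-reflexive eq , ≤ₘ-reflexive (sym ∘ eq)

≡ₘ-sym : ∀ {A B} → A ≡ₘ B → B ≡ₘ A
≡ₘ-sym (r , s) = s , r

≡ₘ-trans : ∀ {A B C} → A ≡ₘ B → B ≡ₘ C → A ≡ₘ C
≡ₘ-trans {A} {B} {C} (r , s) (t , u) = ≤ₘ-trans {A} {B} {C} r t , ≤ₘ-trans {C} {B} {A} u s

tail-≤ₘ : ∀ {A} → A ∘ suc ≤ₘ A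
tail-≤ₘ {A} = reduction {B = A} suc (computable (sucᵈ headᵈ)) (λ _ → refl)

caseℕ : ℕ → (ℕ → ℕ) → ℕ → ℕ
caseℕ a f zero    = a
caseℕ a f (suc n) = f n

caseℕ-computable : ∀ a {f} → Computable f → Computable (caseℕ a f)
caseℕ-computable a {f} (c , cr) = precᶜ (code aᵈ) step-code , go
  where
  aᵈ        = constᵈ a
  step-code = compᶜ c (projᶜ zero ∷ [])

  go : ∀ t → ⟦ precᶜ (code aᵈ) step-code ⟧ (λ ()) (t ∷ []) (caseℕ a f t)
  go zero    = runs aᵈ (λ ()) []
  go (suc t) = caseℕ a f t , go t , t ∷ [] , (refl , tt) , cr t

≤ₘ-from-tail : ∀ {A B} a → A 0 ≡ B a → A ∘ suc ≤ₘ B → A ≤ₘ B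
≤ₘ-from-tail {A} {B} a eq r@(f , c , _) = reduction (caseℕ a f) (caseℕ-computable a c)
  λ { zero → eq ; (suc n) → reduction⁻¹ {A ∘ suc} {B} r n }

Nontrivial : 2^ℕ → Set
Nontrivial A = (∃ λ a → A a ≡ false) × (∃ λ a → A a ≡ true)

-- Whatever the truth value of the deleted entry, it still occurs in the tail, so index 0 can be
-- sent to such a place.
tail-≡ₘ : ∀ {A} → Nontrivial (A ∘ suc) → A ∘ suc ≡ₘ A
tail-≡ₘ {A} ((a₀ , p₀) , (a₁ , p₁)) = tail-≤ₘ {A} , back (A 0) refl
  where
  back : ∀ b → A 0 ≡ b → A ≤ₘ A ∘ suc
  back false eq = ≤ₘ-from-tail a₀ (trans eq (sym p₀)) (≤ₘ-reflexive (λ _ → refl))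
  back true  eq = ≤ₘ-from-tail a₁ (trans eq (sym p₁)) (≤ₘ-reflexive (λ _ → refl))

drop-≡ₘ : ∀ d {A} → Nontrivial (A ∘ (d +_)) → A ∘ (d +_) ≡ₘ A
drop-≡ₘ zero    nt = ≡ₘ-reflexive (λ _ → refl)
drop-≡ₘ (suc d) nt@((a₀ , p₀) , (a₁ , p₁)) =
  ≡ₘ-trans (drop-≡ₘ d nt) (tail-≡ₘ ((d + a₀ , p₀) , (d + a₁ , p₁)))

-- Reductions computed by machine programs

init : ℕ → ℕ → ℕ
init e n = ⟨ push e 0 , ⟨ n , 0 ⟩ ⟩

initᵈ : Def F → Def G → Def (λ α xs → init (F α xs) (G α xs))
initᵈ c d = ⟨ pushᵈ c zeroᵈ , ⟨ d , zeroᵈ ⟩ᵈ ⟩ᵈ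

stack value : ℕ → ℕ → ℕ → ℕ
stack e n s = π₁ (run s (init e n))
value e n s = π₂ (run s (init e n))

stackᵈ : Def F → Def G → Def H → Def (λ α xs → stack (F α xs) (G α xs) (H α xs))
stackᵈ c d e = π₁ᵈ (runᵈ e (initᵈ c d))

valueᵈ : Def F → Def G → Def H → Def (λ α xs → value (F α xs) (G α xs) (H α xs))
valueᵈ c d e = π₂ᵈ (runᵈ e (initᵈ c d))

-- Totality of the program `e` is built in, since every input must have a halting time. The
-- condition has the shape `∀ n ∃ s` over a decidable matrix, which is the source of the bound Π⁰₂.
ReducesBy : ℕ → 2^ℕ → 2^ℕ → Set
ReducesBy e A B = ∀ n → ∃ λ s → stack e n s ≡ 0 × A n ≡ B (value e n s)

ReducesBy-resp : ∀ {e A A′ B B′} → (∀ n → A n ≡ A′ n) → (∀ n → B n ≡ B′ n) →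
                 ReducesBy e A B → ReducesBy e A′ B′
ReducesBy-resp p q r n with s , h , eq ← r n =
  s , h , trans (sym (p n)) (trans eq (q _))

-- `μᶜ` requires the first zero, with successors before it, whereas `ReducesBy` supplies some zero.
least-zero : (h : ℕ → ℕ) → ∀ s → h s ≡ 0 →
             ∃ λ t → h t ≡ 0 × (∀ i → i < t → ∃ λ z → h i ≡ suc z)
least-zero h zero    p = 0 , p , λ _ ()
least-zero h (suc s) p with h 0 in eq
... | zero  = 0 , eq , λ _ ()
... | suc z with t , q , below ← least-zero (h ∘ suc) s p =
  suc t , q , λ { zero _ → z , eq ; (suc i) (s≤s i<t) → below i i<t }

-- The reduction searches for the least halting time and then reads off the value.
ReducesBy⇒≤ₘ : ∀ {e A B} → ReducesBy e A B → A ≤ₘ B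
ReducesBy⇒≤ₘ {e} {A} {B} r = reduction {A} {B} (λ n → value e n (time n)) (c , c-runs) red
  where
  halting : ∀ n → _
  halting n = least-zero (stack e n) (proj₁ (r n)) (proj₁ (proj₂ (r n)))

  time : ℕ → ℕ
  time n = proj₁ (halting n)

  stackᶜ : Def {0} {2} (λ _ xs → stack e (lookup xs (suc zero)) (lookup xs zero))
  stackᶜ = stackᵈ (constᵈ e) (varᵈ (suc zero)) (varᵈ zero)

  valueᶜ : Def {0} {2} (λ _ xs → value e (lookup xs (suc zero)) (lookup xs zero))
  valueᶜ = valueᵈ (constᵈ e) (varᵈ (suc zero)) (varᵈ zero)

  c : Code 0 1
  c = compᶜ (code valueᶜ) (μᶜ (code stackᶜ) ∷ projᶜ zero ∷ [])

  c-runs : ∀ n → ⟦ c ⟧ (λ ()) (n ∷ []) (value e n (time n))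
  c-runs n = time n ∷ n ∷ [] , ((at-time , before) , refl , tt) , runs valueᶜ (λ ()) _
    where
    stack-runs : ∀ s {y} → stack e n s ≡ y → ⟦ code stackᶜ ⟧ (λ ()) (s ∷ n ∷ []) y
    stack-runs s eq = subst (⟦ code stackᶜ ⟧ (λ ()) (s ∷ n ∷ [])) eq (runs stackᶜ (λ ()) _)

    at-time = stack-runs (time n) (proj₁ (proj₂ (halting n)))

    before : ∀ i → i < time n → ∃ λ z → ⟦ code stackᶜ ⟧ (λ ()) (i ∷ n ∷ []) (suc z)
    before i i<t = let z , eq = proj₂ (proj₂ (halting n)) i i<t in z , stack-runs i eq

  red : Red (λ n → value e n (time n)) A B
  red n = let s , h , eq = r n in
    -- The time `s` given by `r` may exceed the least one, but both configurations are halted and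
    -- hence equal.
    trans eq (cong (B ∘ π₂) (run-halted-unique s (time n) _ h (proj₁ (proj₂ (halting n)))))

≤ₘ⇒ReducesBy : ∀ {A B} → A ≤ₘ B → ∃ λ e → ReducesBy e A B
≤ₘ⇒ReducesBy {A} {B} r@(f , (c , cr) , _) = compile c , by
  where
  by : ReducesBy (compile c) A B
  -- Above the empty stack 0 the compiled program ends in the halted configuration `⟨ 0 , f n ⟩`.
  by n with s , eq ← compile-runs c (n ∷ []) (f n) (cr n) 0 =
    s , trans (cong π₁ eq) (π₁-⟨⟩ 0 (f n)) ,
    trans (reduction⁻¹ {A} {B} r n) (cong B (sym (trans (cong π₂ eq) (π₂-⟨⟩ 0 (f n)))))

-- The graph

Marked : 2^ℕ → ℕ → Set
Marked C e = (∀ i → i < suc e → C i ≡ true) × C (suc e) ≡ false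

payload : 2^ℕ → ℕ → 2^ℕ
payload C e n = C (suc (suc e) + n)

-- Nontriviality allows the tag in front of `B` to be removed within the m-degree. The equality
-- alternative links `B` to its own tagged copy, whatever programs the tag names.
Linked : 2^ℕ → 2^ℕ → ℕ → Set
Linked A B e = Nontrivial B ×
  ((∀ n → A n ≡ B n) ⊎ (ReducesBy (π₁ e) A B × ReducesBy (π₂ e) B A))

Arc : 2^ℕ → 2^ℕ → Set
Arc A C = ∃ λ e → Marked C e × Linked A (payload C e) e

-- An explicit index of disagreement makes this Σ⁰₁, so excluding loops keeps the edges Π⁰₂.
Distinct : 2^ℕ → 2^ℕ → Set
Distinct A B = ∃ λ n → ¬ A n ≡ B n

Edge : 2^ℕ → 2^ℕ → Set
Edge A B = (Arc A B ⊎ Arc B A) × Distinct A B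

-- The shorter of two different tags would require a 0 where the longer one requires a 1.
Marked-unique : ∀ {C e e′} → Marked C e → Marked C e′ → e ≡ e′
Marked-unique {C} {e} {e′} (p , q) (p′ , q′) = ≤-antisym
  (≮⇒≥ (λ e′<e → absurd (p (suc e′) (s≤s e′<e)) q′))
  (≮⇒≥ (λ e<e′ → absurd (p′ (suc e) (s≤s e<e′)) q))
  where
  absurd : ∀ {b} → b ≡ true → b ≡ false → ⊥
  absurd refl ()

Arc-resp : ∀ {A A′ C C′} → (∀ n → A n ≡ A′ n) → (∀ n → C n ≡ C′ n) → Arc A C → Arc A′ C′
Arc-resp {A} {A′} {C} {C′} p q (e , (ones , zer) , ((a₀ , p₀) , (a₁ , p₁)) , l) =
  e , ((λ i i≤e → trans (sym (q i)) (ones i i≤e)) , trans (sym (q _)) zer) ,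
  ((a₀ , trans (sym (q _)) p₀) , (a₁ , trans (sym (q _)) p₁)) , link l
  where
  link : _ → _
  link (inj₁ eq)      = inj₁ λ n → trans (sym (p n)) (trans (eq n) (q _))
  link (inj₂ (r , s)) = inj₂
    (ReducesBy-resp {A = A} {B = payload C e} p (λ _ → q _) r
    , ReducesBy-resp {A = payload C e} {B = A} (λ _ → q _) p s)

Edge-resp : ∀ {A A′ B B′} → (∀ n → A n ≡ A′ n) → (∀ n → B n ≡ B′ n) → Edge A B → Edge A′ B′
Edge-resp p q (arc , n , A≢B) =
  [ inj₁ ∘ Arc-resp p q , inj₂ ∘ Arc-resp q p ]′ arc ,
  n , λ eq → A≢B (trans (p n) (trans eq (sym (q n))))

Edge-isSimpleGraph : IsSimpleGraph Cantor Edge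
Edge-isSimpleGraph = record
  { respects    = (λ q → Edge-resp (λ _ → refl) q) , (λ p → Edge-resp p (λ _ → refl))
  ; symmetric   = λ { (arc , n , A≢B) → [ inj₂ , inj₁ ]′ arc , n , A≢B ∘ sym }
  ; irreflexive = λ { A≈B (_ , n , A≢B) → A≢B (A≈B n) }
  }

-- Both sets are compared with the payload of `C`: the link handles `A`, and deleting the tag
-- handles `C`.
Arc⇒≡ₘ : ∀ {A C} → Arc A C → A ≡ₘ C
Arc⇒≡ₘ {A} {C} (e , _ , nt , l) = ≡ₘ-trans {B = payload C e} (link l) (drop-≡ₘ (suc (suc e)) nt)
  where
  link : _ → A ≡ₘ payload C e
  link (inj₁ eq)      = ≡ₘ-reflexive eq
  link (inj₂ (r , s)) = ReducesBy⇒≤ₘ {π₁ e} {A} {payload C e} r ,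
                        ReducesBy⇒≤ₘ {π₂ e} {payload C e} {A} s

Edge⇒≡ₘ : ∀ {A B} → Edge A B → A ≡ₘ B
Edge⇒≡ₘ (arc , _) = [ Arc⇒≡ₘ , ≡ₘ-sym ∘ Arc⇒≡ₘ ]′ arc

Path⇒≡ₘ : ∀ {l A B} → Path Cantor Edge l A B → A ≡ₘ B
Path⇒≡ₘ (stop A≈B)   = ≡ₘ-reflexive A≈B
Path⇒≡ₘ (step AEB p) = ≡ₘ-trans (Edge⇒≡ₘ AEB) (Path⇒≡ₘ p)

mark : ℕ → 2^ℕ → 2^ℕ
mark e       B zero          = true
mark (suc e) B (suc n)       = mark e B n
mark zero    B (suc zero)    = false
mark zero    B (suc (suc n)) = B n

mark-ones : ∀ e B i → i < suc e → mark e B i ≡ true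
mark-ones e       B zero    _         = refl
mark-ones (suc e) B (suc i) (s≤s i≤e) = mark-ones e B i i≤e
mark-ones zero    B (suc i) (s≤s ())

mark-zero : ∀ e B → mark e B (suc e) ≡ false
mark-zero zero    B = refl
mark-zero (suc e) B = mark-zero e B

payload-mark : ∀ e B n → payload (mark e B) e n ≡ B n
payload-mark zero    B n = refl
payload-mark (suc e) B n = payload-mark e B n

mark-Arc : ∀ {A B} e → Linked A B e → Arc A (mark e B)
mark-Arc {A} {B} e (((a₀ , p₀) , (a₁ , p₁)) , l) =
  e , (mark-ones e B , mark-zero e B) ,
  ((a₀ , trans (payload-mark e B a₀) p₀) , (a₁ , trans (payload-mark e B a₁) p₁)) , link l
  where
  link : _ → _
  link (inj₁ eq)      = inj₁ λ n → trans (eq n) (sym (payload-mark e B n))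
  link (inj₂ (r , s)) = inj₂
    (ReducesBy-resp {A = A} {B = B} (λ _ → refl) (sym ∘ payload-mark e B) r
    , ReducesBy-resp {A = B} {B = A} (sym ∘ payload-mark e B) (λ _ → refl) s)

common-neighbour : ∀ {A B} → Nontrivial B → A ≡ₘ B → ∃ λ C → Arc A C × Arc B C
common-neighbour {A} {B} nt (r , s)
  with p , pr ← ≤ₘ⇒ReducesBy {A} {B} r | q , qr ← ≤ₘ⇒ReducesBy {B} {A} s =
  mark ⟨ p , q ⟩ B ,
  mark-Arc ⟨ p , q ⟩ (nt , inj₂ (subst (λ e → ReducesBy e A B) (sym (π₁-⟨⟩ p q)) pr
                               , subst (λ e → ReducesBy e B A) (sym (π₂-⟨⟩ p q)) qr)) ,
  -- `B` equals the payload, so it is linked under any tag.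
  mark-Arc ⟨ p , q ⟩ (nt , inj₁ (λ _ → refl))

-- Π⁰₂ normal forms

-- A form `∀ m ∃ s` whose matrix is a total recursive function, with 0 for truth. Closure properties
-- become arithmetic on matrices.
record Normal {k n} (P : Pointset k n) : Set where
  field
    matrix  : Fun k (suc (suc n))
    matrixᵈ : Def matrix
    to      : ∀ α xs → P α xs → ∀ m → ∃ λ s → matrix α (s ∷ m ∷ xs) ≡ 0
    from    : ∀ α xs → (∀ m → ∃ λ s → matrix α (s ∷ m ∷ xs) ≡ 0) → P α xs

open Normal

private variable
  P Q : Pointset k n

Normal⇒Π⁰₂ : Normal P → Π⁰ 2 P
Normal⇒Π⁰₂ N =
  forall′ (exists (recursive {P = λ α xs → matrix N α xs ≡ 0} decide)
                  (λ α xs → mk⇔ id id))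
          (λ α xs → mk⇔ (to N α xs) (from N α xs))
  where
  c = ifzᵈ (matrixᵈ N) (constᵈ 1) zeroᵈ

  zero-test : ∀ v → ∃ λ b → ifz v 1 0 ≡ bit b × Reflects (v ≡ 0) b
  zero-test zero    = true  , refl , ofʸ refl
  zero-test (suc _) = false , refl , ofⁿ λ ()

  decide : Recursive (λ α xs → matrix N α xs ≡ 0)
  decide = code c , λ α xs →
    let b , eq , reflects = zero-test (matrix N α xs)
    in b , subst (⟦ code c ⟧ α xs) eq (runs c α xs) , reflects

-- A Σ⁰₁ condition with a dummy universal variable, instantiated at 0 to get back.
∃-normal : {F : Fun k (suc n)} → Def F →
           (∀ α xs → P α xs ⇔ (∃ λ s → F α (s ∷ xs) ≡ 0)) → Normal P
∃-normal {F = F} c iff = record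
  { matrix  = λ α xs → F α (head xs ∷ tail (tail xs))
  ; matrixᵈ = substᵈ c (headᵈ ∷ᵈ tail²ᵈ)
  ; to      = λ α xs p _ → Equivalence.to (iff α xs) p
  ; from    = λ α xs h → Equivalence.from (iff α xs) (h 0)
  }

-- Universal variables and witnesses are paired, and a sum vanishes only if both summands do. To
-- recover one conjunct, the variable of the other is set to 0.
×-normal : Normal P → Normal Q → Normal (λ α xs → P α xs × Q α xs)
×-normal {P = P} {Q = Q} N M = record
  { matrix  = λ α xs →
      matrix N α (π₁ (head xs) ∷ π₁ (head (tail xs)) ∷ tail (tail xs)) +
      matrix M α (π₂ (head xs) ∷ π₂ (head (tail xs)) ∷ tail (tail xs))
  ; matrixᵈ =
      substᵈ (matrixᵈ N) (π₁ᵈ headᵈ ∷ᵈ π₁ᵈ secondᵈ ∷ᵈ tail²ᵈ) +ᵈ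
      substᵈ (matrixᵈ M) (π₂ᵈ headᵈ ∷ᵈ π₂ᵈ secondᵈ ∷ᵈ tail²ᵈ)
  ; to      = λ α xs (p , q) m →
      let s , hs = to N α xs p (π₁ m)
          t , ht = to M α xs q (π₂ m)
      in ⟨ s , t ⟩ , cong₂ _+_
           (trans (cong (λ s → matrix N α (s ∷ _ ∷ xs)) (π₁-⟨⟩ s t)) hs)
           (trans (cong (λ s → matrix M α (s ∷ _ ∷ xs)) (π₂-⟨⟩ s t)) ht)
  ; from    = λ α xs h →
      from N α xs (λ m → let s , eq = h ⟨ m , 0 ⟩ in
        π₁ s , trans (cong (λ m → matrix N α (π₁ s ∷ m ∷ xs)) (sym (π₁-⟨⟩ m 0)))
                     (m+n≡0⇒m≡0 _ eq)) ,
      from M α xs (λ m → let s , eq = h ⟨ 0 , m ⟩ in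
        π₂ s , trans (cong (λ m → matrix M α (π₂ s ∷ m ∷ xs)) (sym (π₂-⟨⟩ 0 m)))
                     (m+n≡0⇒n≡0 (matrix N α (π₁ s ∷ π₁ ⟨ 0 , m ⟩ ∷ xs)) eq))
  }

-- Uniqueness of e makes the witnesses for different m agree, so that the
-- quantifier over e may be moved inside the one over m.
∃!-normal : {U : Fun k (suc n)} → Def U →
            (∀ α xs e e′ → U α (e ∷ xs) ≡ 0 → U α (e′ ∷ xs) ≡ 0 → e ≡ e′) →
            Normal P → Normal (λ α xs → ∃ λ e → U α (e ∷ xs) ≡ 0 × P α (e ∷ xs))
∃!-normal {U = U} c unique N = record
  { matrix  = λ α xs →
      U α (π₁ (head xs) ∷ tail (tail xs)) +
      matrix N α (π₂ (head xs) ∷ head (tail xs) ∷ π₁ (head xs) ∷ tail (tail xs))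
  ; matrixᵈ =
      substᵈ c (π₁ᵈ headᵈ ∷ᵈ tail²ᵈ) +ᵈ
      substᵈ (matrixᵈ N) (π₂ᵈ headᵈ ∷ᵈ secondᵈ ∷ᵈ π₁ᵈ headᵈ ∷ᵈ tail²ᵈ)
  ; to      = λ α xs (e , u , p) m →
      let s , hs = to N α (e ∷ xs) p m
      in ⟨ e , s ⟩ , cong₂ _+_
           (trans (cong (λ e → U α (e ∷ xs)) (π₁-⟨⟩ e s)) u)
           (trans (cong₂ (λ s e → matrix N α (s ∷ m ∷ e ∷ xs)) (π₂-⟨⟩ e s) (π₁-⟨⟩ e s)) hs)
  ; from    = λ α xs h →
      let U₀ : ∀ m → U α (π₁ (proj₁ (h m)) ∷ xs) ≡ 0
          U₀ m = m+n≡0⇒m≡0 _ (proj₂ (h m))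
          e = π₁ (proj₁ (h 0))
      in e , U₀ 0 , from N α (e ∷ xs) λ m →
        π₂ (proj₁ (h m)) ,
        trans (cong (λ e → matrix N α (π₂ (proj₁ (h m)) ∷ m ∷ e ∷ xs)) (unique α xs _ _ (U₀ 0) (U₀ m)))
              (m+n≡0⇒n≡0 (U α (π₁ (proj₁ (h m)) ∷ xs)) (proj₂ (h m)))
  }

normal-cong : (∀ α xs → P α xs ⇔ Q α xs) → Normal P → Normal Q
normal-cong iff N = record
  { matrix  = matrix N
  ; matrixᵈ = matrixᵈ N
  ; to      = λ α xs q → to N α xs (Equivalence.from (iff α xs) q)
  ; from    = λ α xs h → Equivalence.to (iff α xs) (from N α xs h)
  }

-- Normal forms for the ingredients of the graph

misses : 2^ℕ → ℕ → ℕ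
misses C zero    = 0
misses C (suc n) = (1 ∸ bit (C n)) + misses C n

misses⇒ones : ∀ C n → misses C n ≡ 0 → ∀ i → i < n → C i ≡ true
misses⇒ones C (suc n) h i i<1+n with C n in eq | h | m<1+n⇒m<n∨m≡n i<1+n
... | true | h′ | inj₁ i<n  = misses⇒ones C n h′ i i<n
... | true | _  | inj₂ refl = eq

ones⇒misses : ∀ C n → (∀ i → i < n → C i ≡ true) → misses C n ≡ 0
ones⇒misses C zero    ones = refl
ones⇒misses C (suc n) ones
  rewrite ones n ≤-refl = ones⇒misses C n (λ i i<n → ones i (m<n⇒m<1+n i<n))

missesᵈ : (i : Fin k) → Def F → Def (λ α xs → misses (α i) (F α xs))
missesᵈ i = recᵈ (λ α _ → misses (α i)) zeroᵈ
  ((constᵈ 1 ∸ᵈ oracleᵈ i headᵈ) +ᵈ secondᵈ) (λ _ _ → refl) (λ _ _ _ → refl)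

-- `misses` counts zeros below a bound, which turns the bounded quantifier in `Marked` into a zero
-- test.
markedness : 2^ℕ → ℕ → ℕ
markedness C e = misses C (suc e) + bit (C (suc e))

markedness⇒Marked : ∀ {C e} → markedness C e ≡ 0 → Marked C e
markedness⇒Marked {C} {e} h =
  misses⇒ones C (suc e) (m+n≡0⇒m≡0 _ h) , bit≡0 _ (m+n≡0⇒n≡0 (misses C (suc e)) h)
  where
  bit≡0 : ∀ b → bit b ≡ 0 → b ≡ false
  bit≡0 false _ = refl

Marked⇒markedness : ∀ {C e} → Marked C e → markedness C e ≡ 0
Marked⇒markedness {C} {e} (ones , zer) =
  cong₂ _+_ (ones⇒misses C (suc e) ones) (cong bit zer)

payloadᵈ : (j : Fin k) → Def F → Def G → Def (λ α xs → bit (payload (α j) (F α xs) (G α xs)))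
payloadᵈ j c d = oracleᵈ j (sucᵈ (sucᵈ c) +ᵈ d)

Distinct-normal : (i j : Fin k) → Normal {k} {n} (λ α _ → Distinct (α i) (α j))
-- On bits, subtracting the distance from 1 gives 0 exactly when they differ.
Distinct-normal i j = ∃-normal (constᵈ 1 ∸ᵈ diffᵈ (oracleᵈ i headᵈ) (oracleᵈ j headᵈ))
  λ α xs → mk⇔ (λ (s , ne) → s , to₁ _ _ ne) (λ (s , eq) → s , from₁ _ _ eq)
  where
  to₁ : ∀ a b → ¬ a ≡ b → 1 ∸ diff (bit a) (bit b) ≡ 0
  to₁ false false ne = ⊥-elim (ne refl)
  to₁ false true  ne = refl
  to₁ true  false ne = refl
  to₁ true  true  ne = ⊥-elim (ne refl)

  from₁ : ∀ a b → 1 ∸ diff (bit a) (bit b) ≡ 0 → ¬ a ≡ b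
  from₁ false .false () refl
  from₁ true  .true  () refl

Nontrivial-normal : (j : Fin k) →
                    Normal {k} {1} (λ α xs → Nontrivial (payload (α j) (head xs)))
Nontrivial-normal {k} j = ×-normal
  (∃-normal (diffᵈ value-at (constᵈ 0)) (iff false))
  (∃-normal (diffᵈ value-at (constᵈ 1)) (iff true))
  where
  value-at = payloadᵈ j secondᵈ headᵈ

  iff : ∀ b (α : Fin k → 2^ℕ) (xs : Vec ℕ 1) →
        (∃ λ a → payload (α j) (head xs) a ≡ b) ⇔
        (∃ λ a → diff (bit (payload (α j) (head xs) a)) (bit b) ≡ 0)
  iff b α (e ∷ []) = mk⇔ (λ (a , eq) → a , diff-bit eq) (λ (a , eq) → a , diff-bit⁻¹ _ b eq)

-- A Π⁰₁ condition: the matrix is constant in the existential variable, and 0 serves as witness.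
Equal-normal : (i j : Fin k) →
               Normal {k} {1} (λ α xs → ∀ n → α i n ≡ payload (α j) (head xs) n)
Equal-normal i j = record
  { matrixᵈ = diffᵈ (oracleᵈ i secondᵈ) (payloadᵈ j thirdᵈ secondᵈ)
  ; to      = λ { α (e ∷ []) eq n → 0 , diff-bit (eq n) }
  ; from    = λ { α (e ∷ []) h n → diff-bit⁻¹ _ _ (proj₂ (h n)) }
  }

-- Letting both sets depend on the tag covers the two directions between a set and a payload.
ReducesBy-normal : {E : Fun k 1} {A B : (Fin k → 2^ℕ) → ℕ → 2^ℕ} → Def E →
  (∀ {n} {F G : Fun k n} → Def F → Def G → Def (λ α xs → bit (A α (F α xs) (G α xs)))) →
  (∀ {n} {F G : Fun k n} → Def F → Def G → Def (λ α xs → bit (B α (F α xs) (G α xs)))) →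
  Normal (λ α xs → ReducesBy (E α xs) (A α (head xs)) (B α (head xs)))
ReducesBy-normal eᵈ aᵈ bᵈ = record
  { matrixᵈ = stackᵈ programᵈ secondᵈ headᵈ +ᵈ
              diffᵈ (aᵈ thirdᵈ secondᵈ) (bᵈ thirdᵈ (valueᵈ programᵈ secondᵈ headᵈ))
  ; to      = λ { α (x ∷ []) r n → let s , h , eq = r n in s , cong₂ _+_ h (diff-bit eq) }
  ; from    = λ { α (x ∷ []) r n → let s , eq = r n in
                  s , m+n≡0⇒m≡0 _ eq , diff-bit⁻¹ _ _ (m+n≡0⇒n≡0 (stack _ n s) eq) }
  }
  where programᵈ = substᵈ eᵈ tail²ᵈ

-- Disjunctions and the complexity of the edge relation

module Classical (em : ExcludedMiddle 0ℓ) where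

  -- (∀ m ∃ s R m s) ∨ (∀ m ∃ s S m s) is classically ∀ m m′ ∃ s (R m s ∨ S m′ s).
  ⊎-normal : Normal P → Normal Q → Normal (λ α xs → P α xs ⊎ Q α xs)
  ⊎-normal {P = P} {Q = Q} N M = record
    -- `ifz a 0 b` vanishes exactly when `a` or `b` does, like a product.
    { matrixᵈ = ifzᵈ (substᵈ (matrixᵈ N) (headᵈ ∷ᵈ π₁ᵈ secondᵈ ∷ᵈ tail²ᵈ)) zeroᵈ
                     (substᵈ (matrixᵈ M) (headᵈ ∷ᵈ π₂ᵈ secondᵈ ∷ᵈ tail²ᵈ))
    ; to      = λ { α xs (inj₁ p) m → let s , eq = to N α xs p (π₁ m) in s , left _ _ eq
                  ; α xs (inj₂ q) m → let s , eq = to M α xs q (π₂ m) in s , right _ _ eq }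
    ; from    = go
    }
    where
    left : ∀ a b → a ≡ 0 → ifz a 0 b ≡ 0
    left zero b _ = refl

    right : ∀ a b → b ≡ 0 → ifz a 0 b ≡ 0
    right zero    b _ = refl
    right (suc _) b h = h

    split : ∀ a b → ifz a 0 b ≡ 0 → a ≡ 0 ⊎ b ≡ 0
    split zero    b _ = inj₁ refl
    split (suc _) b h = inj₂ h

    go : ∀ α xs → (∀ m → ∃ λ s → ifz (matrix N α (s ∷ π₁ m ∷ xs)) 0
                                     (matrix M α (s ∷ π₂ m ∷ xs)) ≡ 0) → P α xs ⊎ Q α xs
    go α xs h with em {P α xs}
    ... | yes p = inj₁ p
    ... | no ¬p = inj₂ (from M α xs λ m₂ → M-at m₂ em)
      where
      M-at : ∀ m₂ → _ → ∃ λ s → matrix M α (s ∷ m₂ ∷ xs) ≡ 0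
      M-at m₂ (yes q) = q
      -- If `m₂` had no witness for `M`, then `h` at the pairs `⟨ m₁ , m₂ ⟩` would give witnesses
      -- for `N` at every `m₁`.
      M-at m₂ (no ¬q) = ⊥-elim (¬p (from N α xs N-at))
        where
        N-at : ∀ m₁ → ∃ λ s → matrix N α (s ∷ m₁ ∷ xs) ≡ 0
        N-at m₁ with s , eq ← h ⟨ m₁ , m₂ ⟩
          rewrite π₁-⟨⟩ m₁ m₂ | π₂-⟨⟩ m₁ m₂ =
          [ (λ a → s , a) , (λ b → ⊥-elim (¬q (s , b))) ]′ (split _ _ eq)

  Arc-normal : (i j : Fin k) → Normal {k} {0} (λ α _ → Arc (α i) (α j))
  Arc-normal i j = normal-cong
    {P = λ α _ → ∃ λ e → markedness (α j) e ≡ 0 × Linked (α i) (payload (α j) e) e}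
    (λ α _ → mk⇔ (λ (e , u , l) → e , markedness⇒Marked u , l)
                 (λ (e , mk , l) → e , Marked⇒markedness mk , l))
    (∃!-normal {P = λ α xs → Linked (α i) (payload (α j) (head xs)) (head xs)}
      (missesᵈ j (sucᵈ headᵈ) +ᵈ oracleᵈ j (sucᵈ headᵈ))
      (λ α _ e e′ u u′ → Marked-unique {α j} (markedness⇒Marked u) (markedness⇒Marked u′))
      (×-normal (Nontrivial-normal j)
        (⊎-normal (Equal-normal i j)
          (×-normal (ReducesBy-normal {A = λ α _ → α i} {λ α → payload (α j)} (π₁ᵈ headᵈ)
                      (λ _ → oracleᵈ i) (payloadᵈ j))
                    (ReducesBy-normal {A = λ α → payload (α j)} {λ α _ → α i} (π₂ᵈ headᵈ)
                      (payloadᵈ j) (λ _ → oracleᵈ i))))))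

  Edge-Π⁰₂ : Π⁰₂ Edge
  Edge-Π⁰₂ = Normal⇒Π⁰₂
    (×-normal (⊎-normal (Arc-normal zero (suc zero)) (Arc-normal (suc zero) zero))
              (Distinct-normal zero (suc zero)))

  -- Connectedness and diameter

  constant-≡ₘ : ∀ {A B b} → (∀ n → B n ≡ b) → A ≡ₘ B → ∀ n → A n ≡ B n
  constant-≡ₘ {A} {B} eq (r , _) n = trans (reduction⁻¹ {A} {B} r n) (trans (eq _) (sym (eq n)))

  Distinct? : ∀ A B → Distinct A B ⊎ (∀ n → A n ≡ B n)
  Distinct? A B with em {Distinct A B}
  ... | yes d = inj₁ d
  ... | no ¬d = inj₂ λ n → eq-at n (em {A n ≡ B n})
    where
    eq-at : ∀ n → _ → A n ≡ B n
    eq-at n (yes eq) = eq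
    eq-at n (no A≢B) = ⊥-elim (¬d (n , A≢B))

  ShortPath : 2^ℕ → 2^ℕ → Set
  ShortPath A B = ∃ λ l → l ≤ 2 × Path Cantor Edge l A B

  -- Edges have distinct ends, so a step on which `C` coincides with an end is dropped from the
  -- path.
  via-neighbour : ∀ {A B C} → Arc A C → Arc B C → ShortPath A B
  via-neighbour {A} {B} {C} a b with Distinct? A C | Distinct? C B
  ... | inj₁ d   | inj₁ d′ =
    2 , ≤-refl , step (inj₁ a , d) (step (inj₂ b , d′) (stop (λ _ → refl)))
  ... | inj₁ d   | inj₂ C≈B = 1 , s≤s z≤n , step (inj₁ a , d) (stop C≈B)
  ... | inj₂ A≈C | inj₁ d′  =
    1 , s≤s z≤n , step (Edge-resp (sym ∘ A≈C) (λ _ → refl) (inj₂ b , d′)) (stop (λ _ → refl))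
  ... | inj₂ A≈C | inj₂ C≈B = 0 , z≤n , stop (λ n → trans (A≈C n) (C≈B n))

  ≡ₘ⇒ShortPath : ∀ {A B} → A ≡ₘ B → ShortPath A B
  ≡ₘ⇒ShortPath {A} {B} A≡B
    with em {∃ λ n → B n ≡ false} | em {∃ λ n → B n ≡ true}
  ... | yes f | yes t with C , a , b ← common-neighbour {A} {B} (f , t) A≡B = via-neighbour a b
  -- A trivial set is alone in its m-degree, so the path of length 0 suffices here and in the next
  -- case.
  ... | no ¬f | _     =
    0 , z≤n , stop (constant-≡ₘ (λ n → ¬-not (λ eq → ¬f (n , eq))) A≡B)
  ... | yes _ | no ¬t =
    0 , z≤n , stop (constant-≡ₘ (λ n → ¬-not (λ eq → ¬t (n , eq))) A≡B)

  diameter≤2 : DiameterAtMost Cantor Edge 2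
  diameter≤2 A B (_ , p) = ≡ₘ⇒ShortPath (Path⇒≡ₘ p)

  ≡ₘ⇔Connected : ∀ A B → A ≡ₘ B ⇔ Connected Cantor Edge A B
  ≡ₘ⇔Connected A B =
    mk⇔ (λ A≡B → let l , _ , p = ≡ₘ⇒ShortPath A≡B in l , p) (Path⇒≡ₘ ∘ proj₂)

  ｛1｝ ｛2｝ : 2^ℕ
  ｛1｝ zero          = false
  ｛1｝ (suc zero)    = true
  ｛1｝ (suc (suc _)) = false
  ｛2｝ zero          = false
  ｛2｝ (suc n)       = ｛1｝ n

  -- Deleting the first entry of `｛2｝` leaves `｛1｝`. Conversely the deleted index can go to 0, which
  -- lies outside `｛1｝`.
  ｛1｝≡ₘ｛2｝ : ｛1｝ ≡ₘ ｛2｝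
  ｛1｝≡ₘ｛2｝ = tail-≤ₘ {｛2｝} , ≤ₘ-from-tail {｛2｝} {｛1｝} 0 refl (≤ₘ-reflexive (λ _ → refl))

  -- An arc in either direction ends in a tagged set, and every tag has a 1 at position 0.
  ¬Edge : ∀ {A B} → A 0 ≡ false → B 0 ≡ false → ¬ Edge A B
  ¬Edge p q (inj₁ (_ , (ones , _) , _) , _) with () ← trans (sym q) (ones 0 z<s)
  ¬Edge p q (inj₂ (_ , (ones , _) , _) , _) with () ← trans (sym p) (ones 0 z<s)

  diameter≥2 : ∀ j → DiameterAtMost Cantor Edge j → 2 ≤ j
  diameter≥2 j diam
    with diam ｛1｝ ｛2｝ (Equivalence.to (≡ₘ⇔Connected ｛1｝ ｛2｝) ｛1｝≡ₘ｛2｝)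
  ... | zero        , _   , stop eq with () ← eq 1
  ... | suc zero    , _   , step e (stop eq) =
    ⊥-elim (¬Edge refl refl (Edge-resp (λ _ → refl) eq e))
  ... | suc (suc l) , l≤j , _ = ≤-trans (s≤s (s≤s z≤n)) l≤j

theorem4p2 : ExcludedMiddle 0ℓ → GraphableWithDiameter Cantor Π⁰₂ _≡ₘ_ 2
theorem4p2 em = record
  { graph         = Edge
  ; isSimpleGraph = Edge-isSimpleGraph
  ; inΓ           = Edge-Π⁰₂
  ; connectedness = ≡ₘ⇔Connected
  ; diameter      = diameter≤2 , diameter≥2
  }
  where open Classical em
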